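{- Let $G$ be a finite simple graph that is $\{K_5-e, K_2\cup 2K_1\}$-free. Then $\chi(G)\le \omega(G)+1$.
   Context: $\chi(G)$ is the chromatic number and $\omega(G)$ the clique number. $K_5-e$ is the complete graph on five vertices with one edge removed. $K_2\cup 2K_1$ is the disjoint union of an edge and two isolated vertices. A graph is $\{H_1,\dots,H_k\}$-free if it has no induced subgraph isomorphic to any $H_i$. -}

module Defs where

open import Data.Nat using (ℕ; suc)
open import Data.Fin using (Fin; zero; suc)
open import Data.Product using (Σ; _×_; ∃; _,_)
import Relation.Binary.PropositionalEquality as Eq
open import Data.Empty using (⊥)
open import Relation.Nullary using (¬_; Dec; yes; no)
open import Relation.Nullary.Decidable using (_×-dec_; ¬?)
open import Data.Fin.Properties using (_≟_)
open import Relation.Binary.PropositionalEquality using (_≡_; _≢_)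
open import Function.Bundles using (_⇔_)
open import Function.Definitions using (Injective)

record Graph (n : ℕ) : Set₁ where
  field
    Adj   : Fin n → Fin n → Set
    adj?  : ∀ i j → Dec (Adj i j)
    sym   : ∀ {i j} → Adj i j → Adj j i
    irrefl : ∀ {i} → ¬ Adj i i
open Graph public

record InducedSub {k n : ℕ} (H : Graph k) (G : Graph n) : Set where
  field
    emb      : Fin k → Fin n
    emb-inj  : Injective _≡_ _≡_ emb
    emb-adj  : ∀ i j → Adj H i j ⇔ Adj G (emb i) (emb j)

Free : {k n : ℕ} → Graph k → Graph n → Set
Free H G = ¬ InducedSub H G

K5e-Adj : Fin 5 → Fin 5 → Set
K5e-Adj i j = i ≢ j × ¬ (i ≡ zero × j ≡ suc zero) × ¬ (i ≡ suc zero × j ≡ zero)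

K5-e : Graph 5
K5-e = record
  { Adj = K5e-Adj
  ; adj? = λ i j → ¬? (i ≟ j) ×-dec ¬? ((i ≟ zero) ×-dec (j ≟ suc zero))
                              ×-dec ¬? ((i ≟ suc zero) ×-dec (j ≟ zero))
  ; sym = λ { (a , b , c) → (λ e → a (Eq.sym e)) , (λ { (x , y) → c (y , x) }) , (λ { (x , y) → b (y , x) }) }
  ; irrefl = λ { (a , _) → a Eq.refl }
  }

data K2∪2K1-Adj : Fin 4 → Fin 4 → Set where
  e01 : K2∪2K1-Adj zero (suc zero)
  e10 : K2∪2K1-Adj (suc zero) zero

K2∪2K1 : Graph 4
K2∪2K1 = record
  { Adj = K2∪2K1-Adj
  ; adj? = dec
  ; sym = λ { e01 → e10 ; e10 → e01 }
  ; irrefl = λ ()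
  }
  where
  dec : ∀ i j → Dec (K2∪2K1-Adj i j)
  dec zero (suc zero) = yes e01
  dec (suc zero) zero = yes e10
  dec zero zero = no λ ()
  dec zero (suc (suc _)) = no λ ()
  dec (suc zero) (suc _) = no λ ()
  dec (suc (suc _)) _ = no λ ()

record Clique {n : ℕ} (G : Graph n) (k : ℕ) : Set where
  field
    vert     : Fin k → Fin n
    vert-inj : Injective _≡_ _≡_ vert
    vert-adj : ∀ i j → i ≢ j → Adj G (vert i) (vert j)

IsCliqueNumber : {n : ℕ} → Graph n → ℕ → Set
IsCliqueNumber G w = Clique G w × ¬ Clique G (suc w)

ProperColouring : {n : ℕ} → Graph n → ℕ → Set
ProperColouring {n} G c = Σ (Fin n → Fin c) λ col → ∀ i j → Adj G i j → col i ≢ col j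

ChromaticAtMost : {n : ℕ} → Graph n → ℕ → Set
ChromaticAtMost G c = ProperColouring G c

{-# OPTIONS --safe #-}
module Submission where

-- Induction on ω, for all induced subgraphs at once.  By K2∪2K1-freeness a vertex outside a
-- maximal independent set S misses at most one vertex of S.  If S meets
-- every clique of size ω, then one colour on S and induction on the rest give ω + 1 colours.
-- Suppose a clique Q of size ω avoids S.  Every s ∈ S misses some q ∈ Q, and for ω ≥ 4 it is
-- adjacent to at most two vertices of Q, by K5-e-freeness.  Counting the non-edges between S and
-- Q excludes |S| > ω in general, |S| ≥ 3 when ω = 4, and every nonempty S when ω ≥ 5.
-- What is left is ω ≤ 4 with a bound on the independence number.  Such graphs are bounded by
-- Ramsey's theorem, in fact they have at most ten vertices, and a search colours all of them.

open import Defs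
open import Data.Nat using (ℕ; zero; suc; _+_; _∸_; _≤_; _≤ᵇ_; z≤n; s≤s)
import Data.Nat.Properties as ℕ
open import Data.Nat.Solver using (module +-*-Solver)
open import Data.Bool using (Bool; true; false; not; _∧_; _∨_; T; T?)
import Data.Bool as Bool
open import Data.Bool.ListAction using (any)
open import Data.Bool.Properties using (T-∧; T-∨)
open import Data.Empty using (⊥; ⊥-elim)
open import Data.Fin using (Fin; zero; suc; punchIn; punchOut; _↑ˡ_)
open import Data.Fin.Patterns using (0F; 1F)
import Data.Fin.Properties as Fin
open import Data.Fin.Subset.Properties using (anySubset?)
open import Data.List as List using (List; []; _∷_; concatMap; filter; filterᵇ; null)
open import Data.List.Membership.Propositional using (_∈_; _∉_; find; lose)
open import Data.List.Membership.Propositional.Properties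
  using (∈-concatMap⁺; ∈-concatMap⁻; ∈-filter⁺; ∈-filter⁻; ∈-map⁻; ∈-allFin; ∈-tabulate⁺; ∈-tabulate⁻)
import Data.List.Membership.DecPropositional as ListDec
open import Data.List.Relation.Unary.Any as Any using (Any; here; there)
open import Data.List.Relation.Unary.Any.Properties using (any⁻)
open import Data.List.Relation.Binary.Subset.Propositional.Properties using (Any-resp-⊆)
open import Data.Product using (Σ; ∃; _×_; _,_; proj₁; proj₂)
open import Data.Sum using (_⊎_; inj₁; inj₂; [_,_]′)
open import Data.Unit using (⊤; tt)
open import Data.Vec as Vec using (Vec; []; _∷_; map; replicate; zipWith; lookup; sum)
import Data.Vec.Membership.Propositional as V
import Data.Vec.Membership.DecPropositional as VecDec
open import Data.Vec.Properties using (≡-dec; lookup∘tabulate)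
open import Data.Vec.Relation.Unary.All as All using (All; []; _∷_)
import Data.Vec.Relation.Unary.All.Properties as All
open import Data.Vec.Relation.Unary.AllPairs using ([]; _∷_)
import Data.Vec.Relation.Unary.Any as VAny
open import Data.Vec.Relation.Unary.Any.Properties using (lookup-index)
open import Data.Vec.Relation.Unary.Unique.Propositional using (Unique)
open import Data.Vec.Relation.Unary.Unique.Propositional.Properties using (lookup-injective)
open import Function.Base using (_∘_; id)
open import Function.Bundles using (Equivalence; mk⇔)
open import Function.Definitions using (Injective)
open import Relation.Binary.PropositionalEquality
  using (_≡_; _≢_; refl; trans; cong; subst; ≢-sym)
import Relation.Binary.PropositionalEquality as Eq
open import Relation.Nullary using (¬_; yes; no; does; proof; contradiction; Reflects; invert)
open import Relation.Nullary.Decidable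
  using (_×-dec_; ¬?; does-⇔; dec-true; dec-false; decidable-stable; from-no; from-yes)
open import Relation.Unary using (Decidable)

-- Exhaustive search over small graphs that avoid given patterns.

-- The adjacency matrix below the diagonal, newest vertex first: the head of a triangle is the
-- row of the newest vertex against all older ones.
data Triangle : ℕ → Set where
  []  : Triangle zero
  _∷_ : ∀ {m} → Vec Bool m → Triangle m → Triangle (suc m)

-- pattern⟨ k , d , b ⟩ stands for 2 + k vertices all but at most d of whose pairs have
-- adjacency b.  One such count covers all vertex orders of a forbidden subgraph.
record Pattern : Set where
  constructor pattern⟨_,_,_⟩
  field
    others     : ℕ
    exceptions : ℕ
    value      : Bool

miss : Bool → Bool → ℕ
miss true  true  = 0
miss true  false = 1
miss false true  = 1
miss false false = 0

-- Keeps each cost equal to the number of exceptional pairs with the vertices chosen so far; `t` is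
-- the row of the last one chosen.
charge : ∀ {m} → Bool → Vec Bool m → Vec ℕ m → Vec ℕ m
charge b = zipWith (λ t c → miss b t + c)

-- Can k more vertices be chosen with at most d exceptional pairs, where choosing a vertex also
-- incurs its entry in the vector of costs?
few : ∀ {m} → ℕ → ℕ → Bool → Vec ℕ m → Triangle m → Bool
few zero    d b cs       g       = true
few (suc k) d b []       []      = false
few (suc k) d b (c ∷ cs) (r ∷ g) =
  ((c ≤ᵇ d) ∧ few k (d ∸ c) b (charge b r cs) g) ∨ few (suc k) d b cs g

-- Only choices containing both the candidate, with row `a ∷ s`, and the newest vertex, with row
-- `t`, are examined; these are the 2 in `2 + k`. A choice of the candidate and older vertices was
-- examined when the newest of those joined.
clash : ∀ {m} → Vec Bool (suc m) → Vec Bool m → Triangle m → Pattern → Bool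
clash (a ∷ s) t g pattern⟨ k , d , b ⟩ =
  (miss b a ≤ᵇ d) ∧ few k (d ∸ miss b a) b (charge b s (charge b t (replicate _ 0))) g

fits : ∀ {c m} → Vec Bool m → Vec (Fin c) m → Fin c → Bool
fits []      []      x = true
fits (b ∷ r) (y ∷ κ) x = not (b ∧ does (x Fin.≟ y)) ∧ fits r κ x

recolour : ∀ {c m} → Vec Bool m → List (Vec (Fin c) m) → List (Vec (Fin c) (suc m))
recolour {c} t = concatMap λ κ → List.map (_∷ κ) (filterᵇ (fits t κ) (List.allFin c))

compatible? : ∀ {m} (pats : List Pattern) (t : Vec Bool m) (g : Triangle m) →
  Decidable (λ s → ¬ T (any (clash s t g) pats))
compatible? pats t g s = ¬? (T? (any (clash s t g) pats))

extend : ∀ {m} → List Pattern → Vec Bool m → Triangle m → List (Vec Bool m) → List (Vec Bool (suc m))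
extend pats t g = concatMap λ s → filter (compatible? pats t g) ((false ∷ s) ∷ (true ∷ s) ∷ [])

-- D lists the possible rows of the vertices not yet in the triangle g, and κs the colourings of g.
-- Either some remaining vertex has row t, and it joins g, or t is dropped from D for good: the
-- vertices thus arrive sorted by row, which removes most relabellings of the same graph.
-- The number f only bounds the recursion depth.
search : ∀ {c m} → List Pattern → ℕ → Triangle m → List (Vec (Fin c) m) → List (Vec Bool m) → Bool
search pats zero    g κs D       = false
search pats (suc f) g κs []      = not (null κs)
search pats (suc f) g κs (t ∷ D) =
  search pats f (t ∷ g) (recolour t κs) (extend pats t g (t ∷ D)) ∧ search pats f g κs D

-- The index is ω.  In patterns₃, four vertices spanning at most one edge are independent or
-- induce K2∪2K1; in patterns₄, five vertices missing at most one edge induce K5 or K5-e.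
patterns₁ patterns₂ patterns₃ patterns₄ : List Pattern
patterns₁ = pattern⟨ 0 , 0 , false ⟩ ∷ pattern⟨ 0 , 0 , true ⟩ ∷ []
patterns₂ = pattern⟨ 1 , 0 , false ⟩ ∷ pattern⟨ 1 , 0 , true ⟩ ∷ []
patterns₃ = pattern⟨ 2 , 1 , false ⟩ ∷ pattern⟨ 2 , 0 , true ⟩ ∷ []
patterns₄ = pattern⟨ 1 , 0 , false ⟩ ∷ pattern⟨ 3 , 1 , true ⟩ ∷ []

-- A record rather than a synonym, so that comparing two instances never runs the search.
record Verified (c : ℕ) (pats : List Pattern) : Set where
  constructor verified
  field
    fuel      : ℕ
    succeeded : T (search {suc c} pats fuel [] ([] ∷ []) ([] ∷ []))

-- Type checking `tt` runs the search with ω + 1 colours; success also shows that the depth 500 was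
-- never exhausted.
verified₁ : Verified 1 patterns₁
verified₁ = verified 500 tt

verified₂ : Verified 2 patterns₂
verified₂ = verified 500 tt

verified₃ : Verified 3 patterns₃
verified₃ = verified 500 tt

verified₄ : Verified 4 patterns₄
verified₄ = verified 500 tt

-- Combinatorics of small finite index sets.

∀-⊎ : ∀ {n} {P : Fin n → Set} {B : Set} → (∀ i → P i ⊎ B) → (∀ i → P i) ⊎ B
∀-⊎ {zero}  h = inj₁ λ ()
∀-⊎ {suc n} h with h zero | ∀-⊎ (h ∘ suc)
... | inj₁ p | inj₁ ps = inj₁ λ { zero → p ; (suc i) → ps i }
... | inj₂ b | _       = inj₂ b
... | inj₁ _ | inj₂ b  = inj₂ b

-- The injection of Fin (2 + k) into itself that sends 0 to i and 1 to j.
pairFirst : ∀ {k} {i j : Fin (2 + k)} → i ≢ j → Fin (2 + k) → Fin (2 + k)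
pairFirst {i = i} i≢j zero          = i
pairFirst {i = i} i≢j (suc zero)    = punchIn i (punchOut i≢j)
pairFirst {i = i} i≢j (suc (suc x)) = punchIn i (punchIn (punchOut i≢j) x)

pairFirst-one : ∀ {k} {i j : Fin (2 + k)} (i≢j : i ≢ j) → pairFirst i≢j (suc zero) ≡ j
pairFirst-one = Fin.punchIn-punchOut

pairFirst-injective : ∀ {k} {i j : Fin (2 + k)} (i≢j : i ≢ j) → Injective _≡_ _≡_ (pairFirst i≢j)
pairFirst-injective {i = i} i≢j {zero} {zero} eq = refl
pairFirst-injective {i = i} i≢j {zero} {suc zero} eq = contradiction (Eq.sym eq) (Fin.punchInᵢ≢i i _)
pairFirst-injective {i = i} i≢j {zero} {suc (suc y)} eq = contradiction (Eq.sym eq) (Fin.punchInᵢ≢i i _)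
pairFirst-injective {i = i} i≢j {suc zero} {zero} eq = contradiction eq (Fin.punchInᵢ≢i i _)
pairFirst-injective {i = i} i≢j {suc (suc x)} {zero} eq = contradiction eq (Fin.punchInᵢ≢i i _)
pairFirst-injective {i = i} i≢j {suc zero} {suc zero} eq = refl
pairFirst-injective {i = i} i≢j {suc zero} {suc (suc y)} eq =
  contradiction (Eq.sym (Fin.punchIn-injective i _ _ eq)) (Fin.punchInᵢ≢i _ y)
pairFirst-injective {i = i} i≢j {suc (suc x)} {suc zero} eq =
  contradiction (Fin.punchIn-injective i _ _ eq) (Fin.punchInᵢ≢i _ x)
pairFirst-injective {i = i} i≢j {suc (suc x)} {suc (suc y)} eq =
  cong (λ z → suc (suc z)) (Fin.punchIn-injective _ _ _ (Fin.punchIn-injective i _ _ eq))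

third : ∀ (i j : Fin 4) → ∃ λ k → k ≢ i × k ≢ j
third = from-yes (Fin.all? λ (i : Fin 4) → Fin.all? λ (j : Fin 4) → Fin.any? λ (k : Fin 4) →
  ¬? (k Fin.≟ i) ×-dec ¬? (k Fin.≟ j))

Majority : (Fin 5 → Bool) → Set
Majority f = ∃ λ i → ∃ λ j → ∃ λ k → (i ≢ j × i ≢ k × j ≢ k) × f j ≡ f i × f k ≡ f i

majority? : Decidable Majority
majority? f = Fin.any? λ i → Fin.any? λ j → Fin.any? λ k →
  (¬? (i Fin.≟ j) ×-dec ¬? (i Fin.≟ k) ×-dec ¬? (j Fin.≟ k)) ×-dec (f j Bool.≟ f i) ×-dec (f k Bool.≟ f i)

-- `anySubset?` runs through the 32 Boolean vectors of length five. A counterexample `f` is a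
-- function, so it is first tabulated.
majority : ∀ f → Majority f
majority f = decidable-stable (majority? f) λ ¬m →
  from-no (anySubset? (¬? ∘ majority? ∘ lookup))
    (Vec.tabulate f , λ (i , j , k , distinct , ji , ki) → ¬m (i , j , k , distinct , at j i ji , at k i ki))
  where
  at : ∀ x y → lookup (Vec.tabulate f) x ≡ lookup (Vec.tabulate f) y → f x ≡ f y
  at x y eq = trans (Eq.sym (lookup∘tabulate f x)) (trans eq (lookup∘tabulate f y))

miss≡0 : ∀ b t → miss b t ≡ 0 → t ≡ b
miss≡0 true  true  _ = refl
miss≡0 false false _ = refl

-- Counting exceptional pairs, and the two forbidden subgraphs.

module Semantics {n : ℕ} (G : Graph n) where

  adjᵇ : Fin n → Fin n → Bool
  adjᵇ u v = does (adj? G u v)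

  adj⁺ : ∀ {u v} → adjᵇ u v ≡ true → Adj G u v
  adj⁺ {u} {v} eq = invert (subst (Reflects _) eq (proof (adj? G u v)))

  adj⁻ : ∀ {u v} → adjᵇ u v ≡ false → ¬ Adj G u v
  adj⁻ {u} {v} eq = invert (subst (Reflects _) eq (proof (adj? G u v)))

  adjᵇ-sym : ∀ u v → adjᵇ u v ≡ adjᵇ v u
  adjᵇ-sym u v = does-⇔ (mk⇔ (Graph.sym G) (Graph.sym G)) (adj? G u v) (adj? G v u)

  row : ∀ {m} → Fin n → Vec (Fin n) m → Vec Bool m
  row v = map (adjᵇ v)

  triangle : ∀ {m} → Vec (Fin n) m → Triangle m
  triangle []       = []
  triangle (v ∷ vs) = row v vs ∷ triangle vs

  load : ∀ {m} → Bool → Fin n → Vec (Fin n) m → ℕ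
  load b v vs = sum (map (λ u → miss b (adjᵇ v u)) vs)

  -- The number of non-edges for `b = true`, of edges for `b = false`.
  defect : ∀ {m} → Bool → Vec (Fin n) m → ℕ
  defect b []       = 0
  defect b (v ∷ vs) = load b v vs + defect b vs

  Mono : ∀ {m} → Bool → Vec (Fin n) m → Set
  Mono b vs = ∀ i j → i ≢ j → adjᵇ (lookup vs i) (lookup vs j) ≡ b

  -- The adjacency of the pair `i`, `j` itself is left open; `sparse` and `dense` decide it by
  -- cases.
  MonoExcept : ∀ {m} → Bool → Vec (Fin n) m → Fin m → Fin m → Set
  MonoExcept b vs i j = ∀ x y → x ≢ y → ¬ (x ≡ i × y ≡ j) → ¬ (x ≡ j × y ≡ i) →
    adjᵇ (lookup vs x) (lookup vs y) ≡ b

  load≡0 : ∀ {m} b v (vs : Vec (Fin n) m) → load b v vs ≡ 0 → ∀ i → adjᵇ v (lookup vs i) ≡ b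
  load≡0 b v (u ∷ vs) eq zero    = miss≡0 b _ (ℕ.m+n≡0⇒m≡0 _ eq)
  load≡0 b v (u ∷ vs) eq (suc i) = load≡0 b v vs (ℕ.m+n≡0⇒n≡0 (miss b (adjᵇ v u)) eq) i

  load≤1 : ∀ {m} b v (vs : Vec (Fin n) m) → load b v vs ≤ 1 →
    load b v vs ≡ 0 ⊎ (load b v vs ≡ 1 × ∃ λ j → ∀ i → i ≢ j → adjᵇ v (lookup vs i) ≡ b)
  load≤1 b v [] le = inj₁ refl
  load≤1 b v (u ∷ vs) le with miss b (adjᵇ v u) in eq
  ... | suc zero = inj₂ (cong suc l≡0 , zero , λ
          { zero i≢j → contradiction refl i≢j ; (suc i) _ → load≡0 b v vs l≡0 i })
        where l≡0 = ℕ.n≤0⇒n≡0 (ℕ.≤-pred le)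
  ... | zero with load≤1 b v vs le
  ...   | inj₁ l≡0 = inj₁ l≡0
  ...   | inj₂ (l≡1 , j , h) = inj₂ (l≡1 , suc j , λ
          { zero _ → miss≡0 b _ eq ; (suc i) i≢j → h i (i≢j ∘ cong suc) })
  load≤1 b v (u ∷ vs) (s≤s ()) | suc (suc _)

  mono-∷ : ∀ {m} {b v} {vs : Vec (Fin n) m} →
    (∀ i → adjᵇ v (lookup vs i) ≡ b) → Mono b vs → Mono b (v ∷ vs)
  mono-∷ hv hvs zero    zero    i≢j = contradiction refl i≢j
  mono-∷ hv hvs zero    (suc j) i≢j = hv j
  mono-∷ hv hvs (suc i) zero    i≢j = trans (adjᵇ-sym _ _) (hv i)
  mono-∷ hv hvs (suc i) (suc j) i≢j = hvs i j (i≢j ∘ cong suc)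

  defect≡0 : ∀ {m} b (vs : Vec (Fin n) m) → defect b vs ≡ 0 → Mono b vs
  defect≡0 b []       eq = λ ()
  defect≡0 b (v ∷ vs) eq = mono-∷ (load≡0 b v vs (ℕ.m+n≡0⇒m≡0 _ eq))
                                  (defect≡0 b vs (ℕ.m+n≡0⇒n≡0 (load b v vs) eq))

  -- A single exception lies either at the head, and then the tail has defect zero, or within the
  -- tail.
  defect≤1 : ∀ {m} b (vs : Vec (Fin n) m) → defect b vs ≤ 1 →
    Mono b vs ⊎ ∃ λ i → ∃ λ j → i ≢ j × MonoExcept b vs i j
  defect≤1 b [] le = inj₁ λ ()
  defect≤1 b (v ∷ vs) le with load≤1 b v vs (ℕ.m+n≤o⇒m≤o _ le)
  ... | inj₂ (l≡1 , j , h) = inj₂ (zero , suc j , (λ ()) , exc)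
    where
    rest : Mono b vs
    rest = defect≡0 b vs (ℕ.n≤0⇒n≡0 (ℕ.≤-pred (subst (λ l → l + defect b vs ≤ 1) l≡1 le)))
    exc : MonoExcept b (v ∷ vs) zero (suc j)
    exc zero    zero    x≢y _ _ = contradiction refl x≢y
    exc zero    (suc y) _   p _ = h y (λ y≡j → p (refl , cong suc y≡j))
    exc (suc x) zero    _   _ q = trans (adjᵇ-sym _ _) (h x (λ x≡j → q (cong suc x≡j , refl)))
    exc (suc x) (suc y) x≢y _ _ = rest x y (x≢y ∘ cong suc)
  ... | inj₁ l≡0 with defect≤1 b vs (ℕ.m+n≤o⇒n≤o (load b v vs) le)
  ...   | inj₁ mono = inj₁ (mono-∷ (load≡0 b v vs l≡0) mono)
  ...   | inj₂ (i , j , i≢j , h) = inj₂ (suc i , suc j , i≢j ∘ Fin.suc-injective , exc)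
    where
    exc : MonoExcept b (v ∷ vs) (suc i) (suc j)
    exc zero    zero    x≢y _ _ = contradiction refl x≢y
    exc zero    (suc y) _   _ _ = load≡0 b v vs l≡0 y
    exc (suc x) zero    _   _ _ = trans (adjᵇ-sym _ _) (load≡0 b v vs l≡0 x)
    exc (suc x) (suc y) x≢y p q = h x y (x≢y ∘ cong suc)
      (λ { (refl , refl) → p (refl , refl) }) (λ { (refl , refl) → q (refl , refl) })

  mono-complete : ∀ {m} {b} {vs : Vec (Fin n) m} {i j} →
    adjᵇ (lookup vs i) (lookup vs j) ≡ b → MonoExcept b vs i j → Mono b vs
  mono-complete {i = i} {j} eq h x y x≢y with x Fin.≟ i ×-dec y Fin.≟ j | x Fin.≟ j ×-dec y Fin.≟ i
  ... | yes (refl , refl) | _                 = eq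
  ... | no _              | yes (refl , refl) = trans (adjᵇ-sym _ _) eq
  ... | no p              | no q              = h x y x≢y p q

  -- `K2∪2K1` has its only edge, and `K5-e` its only non-edge, at 0 and 1, so the exceptional pair
  -- is moved there.
  module Reordered {k b} {vs : Vec (Fin n) (2 + k)} (unique : Unique vs) {i j} (i≢j : i ≢ j)
                   (exc : MonoExcept b vs i j) where

    vertex : Fin (2 + k) → Fin n
    vertex = lookup vs ∘ pairFirst i≢j

    vertex-injective : Injective _≡_ _≡_ vertex
    vertex-injective = pairFirst-injective i≢j ∘ lookup-injective unique _ _

    vertex-mono : ∀ {x y} → x ≢ y → ¬ (x ≡ zero × y ≡ suc zero) → ¬ (x ≡ suc zero × y ≡ zero) →
      adjᵇ (vertex x) (vertex y) ≡ b
    vertex-mono x≢y p q = exc _ _ (x≢y ∘ pairFirst-injective i≢j)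
      (λ (a , c) → p (at0 a , at1 c)) (λ (a , c) → q (at1 a , at0 c))
      where
      at0 : ∀ {x} → pairFirst i≢j x ≡ i → x ≡ zero
      at0 eq = pairFirst-injective i≢j eq
      at1 : ∀ {x} → pairFirst i≢j x ≡ j → x ≡ suc zero
      at1 eq = pairFirst-injective i≢j (trans eq (Eq.sym (pairFirst-one i≢j)))

    vertex-exc : ∀ {t} → adjᵇ (lookup vs i) (lookup vs j) ≡ t → adjᵇ (vertex zero) (vertex (suc zero)) ≡ t
    vertex-exc {t} = subst (λ y → adjᵇ (lookup vs i) (lookup vs y) ≡ t) (Eq.sym (pairFirst-one i≢j))

  -- A lone edge on four vertices would be an induced `K2∪2K1`.
  sparse : Free K2∪2K1 G → (vs : Vec (Fin n) 4) → Unique vs → defect false vs ≤ 1 → Mono false vs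
  sparse free vs unique le with defect≤1 false vs le
  ... | inj₁ mono = mono
  ... | inj₂ (i , j , i≢j , exc) with adjᵇ (lookup vs i) (lookup vs j) in eq
  ...   | false = mono-complete {vs = vs} eq exc
  ...   | true  = ⊥-elim (free record
    { emb = vertex ; emb-inj = vertex-injective ; emb-adj = λ x y → mk⇔ to (from x y) })
    where
    open Reordered unique i≢j exc
    to : ∀ {x y} → K2∪2K1-Adj x y → Adj G (vertex x) (vertex y)
    to e01 = adj⁺ (vertex-exc eq)
    to e10 = Graph.sym G (adj⁺ (vertex-exc eq))
    from : ∀ x y → Adj G (vertex x) (vertex y) → K2∪2K1-Adj x y
    from x y xy with x Fin.≟ y | x Fin.≟ 0F ×-dec y Fin.≟ 1F | x Fin.≟ 1F ×-dec y Fin.≟ 0F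
    ... | yes refl | _ | _ = contradiction xy (irrefl G)
    ... | no _ | yes (refl , refl) | _ = e01
    ... | no _ | no _ | yes (refl , refl) = e10
    ... | no x≢y | no p | no q = contradiction xy (adj⁻ (vertex-mono x≢y p q))

  -- A lone non-edge on five vertices would be an induced `K5-e`.
  dense : Free K5-e G → (vs : Vec (Fin n) 5) → Unique vs → defect true vs ≤ 1 → Mono true vs
  dense free vs unique le with defect≤1 true vs le
  ... | inj₁ mono = mono
  ... | inj₂ (i , j , i≢j , exc) with adjᵇ (lookup vs i) (lookup vs j) in eq
  ...   | true  = mono-complete {vs = vs} eq exc
  ...   | false = ⊥-elim (free record
    { emb = vertex ; emb-inj = vertex-injective
    ; emb-adj = λ x y → mk⇔ (λ (x≢y , p , q) → adj⁺ (vertex-mono x≢y p q)) (from x y) })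
    where
    open Reordered unique i≢j exc
    ¬01 : ¬ Adj G (vertex 0F) (vertex 1F)
    ¬01 = adj⁻ (vertex-exc eq)
    from : ∀ x y → Adj G (vertex x) (vertex y) → K5e-Adj x y
    from x y xy = (λ { refl → irrefl G xy }) , (λ { (refl , refl) → ¬01 xy })
                , (λ { (refl , refl) → ¬01 (Graph.sym G xy) })

  -- Soundness of the search.

  Colourable : (Fin n → Set) → ℕ → Set
  Colourable U c = Σ (Fin n → Fin c) λ col → ∀ i j → U i → U j → Adj G i j → col i ≢ col j

  Occurs : (Fin n → Set) → Pattern → Set
  Occurs U pattern⟨ k , d , b ⟩ =
    Σ (Vec (Fin n) (2 + k)) λ vs → All U vs × Unique vs × defect b vs ≤ d

  fits-sound : ∀ {c m} v (vs : Vec (Fin n) m) (κ : Vec (Fin c) m) {x} → T (fits (row v vs) κ x) →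
    ∀ i → Adj G v (lookup vs i) → x ≢ lookup κ i
  fits-sound v (u ∷ vs) (y ∷ κ) {x} ok zero vu with adj? G v u | x Fin.≟ y
  ... | yes _ | no x≢y = x≢y
  ... | no ¬vu | _ = contradiction vu ¬vu
  fits-sound v (u ∷ vs) (y ∷ κ) ok (suc i) = fits-sound v vs κ (proj₂ (Equivalence.to T-∧ ok)) i

  Proper : ∀ {c m} → Vec (Fin n) m → Vec (Fin c) m → Set
  Proper vs κ = ∀ i j → Adj G (lookup vs i) (lookup vs j) → lookup κ i ≢ lookup κ j

  recolour-sound : ∀ {c m} v (vs : Vec (Fin n) m) {κs : List (Vec (Fin c) m)} →
    (∀ {κ} → κ ∈ κs → Proper vs κ) → ∀ {κ} → κ ∈ recolour (row v vs) κs → Proper (v ∷ vs) κ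
  recolour-sound {c} v vs {κs} proper κ∈ i j ij
    with κ′ , κ′∈ , κ∈′ ← find (∈-concatMap⁻
           (λ κ → List.map (_∷ κ) (filterᵇ (fits (row v vs) κ) (List.allFin c))) {xs = κs} κ∈)
    with x , x∈ , refl ← ∈-map⁻ (_∷ κ′) κ∈′
    with ok ← proj₂ (∈-filter⁻ (T? ∘ fits (row v vs) κ′) {xs = List.allFin c} x∈)
    with i | j
  ... | zero  | zero  = contradiction ij (irrefl G)
  ... | zero  | suc j = fits-sound v vs κ′ ok j ij
  ... | suc i | zero  = ≢-sym (fits-sound v vs κ′ ok i (Graph.sym G ij))
  ... | suc i | suc j = proper κ′∈ i j ij

  -- Keeps the costs in the form `map χ vs`, so that `few-sound` can recurse with a new cost
  -- function.
  charge-map : ∀ {m} b (χ : Fin n → ℕ) v (vs : Vec (Fin n) m) →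
    charge b (row v vs) (map χ vs) ≡ map (λ u → miss b (adjᵇ v u) + χ u) vs
  charge-map b χ v []       = refl
  charge-map b χ v (u ∷ vs) = cong (_ ∷_) (charge-map b χ v vs)

  sum-charge : ∀ {m} b (χ : Fin n → ℕ) v (ps : Vec (Fin n) m) →
    sum (map (λ u → miss b (adjᵇ v u) + χ u) ps) ≡ load b v ps + sum (map χ ps)
  sum-charge b χ v [] = refl
  sum-charge b χ v (p ∷ ps) = trans (cong (miss b (adjᵇ v p) + χ p +_) (sum-charge b χ v ps))
    (solve 4 (λ a b c d → (a :+ b) :+ (c :+ d) := (a :+ c) :+ (b :+ d)) refl
      (miss b (adjᵇ v p)) (χ p) (load b v ps) (sum (map χ ps)))
    where open +-*-Solver

  -- A budget argument: choosing `v` pays `χ v` at once and moves the exceptional pairs at `v` into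
  -- the costs of the later choices.
  few-sound : ∀ {m} k d b (χ : Fin n → ℕ) (vs : Vec (Fin n) m) → Unique vs →
    T (few k d b (map χ vs) (triangle vs)) →
    Σ (Vec (Fin n) k) λ ps → All (V._∈ vs) ps × Unique ps × sum (map χ ps) + defect b ps ≤ d
  few-sound zero d b χ vs _ _ = [] , [] , [] , z≤n
  few-sound (suc k) d b χ (v ∷ vs) (v∉ ∷ uniq) ok with Equivalence.to T-∨ ok
  ... | inj₂ ok′ with ps , ps∈ , u , le ← few-sound (suc k) d b χ vs uniq ok′ =
    ps , All.map VAny.there ps∈ , u , le
  ... | inj₁ ok′
    with c≤d , ok″ ← Equivalence.to (T-∧ {χ v ≤ᵇ d}) ok′
    with ps , ps∈ , u , le ← few-sound k (d ∸ χ v) b (λ u → miss b (adjᵇ v u) + χ u) vs uniq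
           (subst (λ cs → T (few k (d ∸ χ v) b cs (triangle vs))) (charge-map b χ v vs) ok″) =
    v ∷ ps , VAny.here refl ∷ All.map VAny.there ps∈
    , All.map (λ p∈ v≡p → All.lookup v∉ p∈ v≡p) ps∈ ∷ u
    , bound (ℕ.≤ᵇ⇒≤ (χ v) d c≤d) ps le
    where
    bound : ∀ {m} → χ v ≤ d → (ps : Vec (Fin n) m) →
      sum (map (λ u → miss b (adjᵇ v u) + χ u) ps) + defect b ps ≤ d ∸ χ v →
      sum (map χ (v ∷ ps)) + defect b (v ∷ ps) ≤ d
    bound c≤d ps le = begin
      (χ v + X) + (L + D)
        ≡⟨ solve 4 (λ c x l d → (c :+ x) :+ (l :+ d) := c :+ ((l :+ x) :+ d)) refl (χ v) X L D ⟩
      χ v + ((L + X) + D)   ≡⟨ cong (λ s → χ v + (s + D)) (sum-charge b χ v ps) ⟨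
      χ v + (sum (map (λ u → miss b (adjᵇ v u) + χ u) ps) + D)
        ≤⟨ ℕ.+-monoʳ-≤ (χ v) le ⟩
      χ v + (d ∸ χ v)       ≡⟨ ℕ.m+[n∸m]≡n c≤d ⟩
      d ∎
      where
      open +-*-Solver
      open ℕ.≤-Reasoning
      X = sum (map χ ps)
      L = load b v ps
      D = defect b ps

  module SearchSoundness {U : Fin n → Set} (U? : Decidable U) (c : ℕ) (pats : List Pattern) where

    open VecDec (Fin._≟_ {n}) using () renaming (_∈?_ to _∈ᵥ?_)

    charge-twice : ∀ {m} b y x (vs : Vec (Fin n) m) →
      charge b (row y vs) (charge b (row x vs) (replicate _ 0))
        ≡ map (λ u → miss b (adjᵇ y u) + (miss b (adjᵇ x u) + 0)) vs
    charge-twice b y x []       = refl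
    charge-twice b y x (v ∷ vs) = cong (_ ∷_) (charge-twice b y x vs)

    -- `y` and `x` count as already chosen: their own pair is paid first, and `few-sound` starts
    -- from the costs of older vertices against both.
    clash-sound : ∀ {m y x} {vs : Vec (Fin n) m} → Unique (y ∷ x ∷ vs) → All U (y ∷ x ∷ vs) → ∀ P →
      T (clash (row y (x ∷ vs)) (row x vs) (triangle vs) P) → Occurs U P
    clash-sound {y = y} {x} {vs} ((y≢x ∷ y∉) ∷ x∉ ∷ uniq) (Uy ∷ Ux ∷ Uvs) pattern⟨ k , d , b ⟩ ok
      with a≤d , ok′ ← Equivalence.to (T-∧ {miss b (adjᵇ y x) ≤ᵇ d}) ok
      with ps , ps∈ , u , le ← few-sound k (d ∸ miss b (adjᵇ y x)) b
             (λ u → miss b (adjᵇ y u) + (miss b (adjᵇ x u) + 0)) vs uniq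
             (subst (λ cs → T (few k (d ∸ miss b (adjᵇ y x)) b cs (triangle vs))) (charge-twice b y x vs) ok′) =
      y ∷ x ∷ ps
      , Uy ∷ Ux ∷ All.map (λ p∈ → All.lookup Uvs p∈) ps∈
      , (y≢x ∷ All.map (λ p∈ y≡p → All.lookup y∉ p∈ y≡p) ps∈)
        ∷ All.map (λ p∈ x≡p → All.lookup x∉ p∈ x≡p) ps∈ ∷ u
      , bound ps le
      where
      bound : ∀ {m} (ps : Vec (Fin n) m) →
        sum (map (λ u → miss b (adjᵇ y u) + (miss b (adjᵇ x u) + 0)) ps) + defect b ps
          ≤ d ∸ miss b (adjᵇ y x) →
        defect b (y ∷ x ∷ ps) ≤ d
      bound ps le = begin
        (a + Y) + (X + D)
          ≡⟨ solve 4 (λ a y x d → (a :+ y) :+ (x :+ d) := a :+ ((y :+ (x :+ con 0)) :+ d)) refl a Y X D ⟩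
        a + ((Y + (X + 0)) + D)    ≡⟨ cong (λ z → a + ((Y + (X + z)) + D)) (zeros ps) ⟨
        a + ((Y + (X + sum (map (λ _ → 0) ps))) + D)
          ≡⟨ cong (λ z → a + ((Y + z) + D)) (sum-charge b (λ _ → 0) x ps) ⟨
        a + ((Y + sum (map (λ u → miss b (adjᵇ x u) + 0) ps)) + D)
          ≡⟨ cong (λ z → a + (z + D)) (sum-charge b (λ u → miss b (adjᵇ x u) + 0) y ps) ⟨
        a + (sum (map (λ u → miss b (adjᵇ y u) + (miss b (adjᵇ x u) + 0)) ps) + D)
          ≤⟨ ℕ.+-monoʳ-≤ a le ⟩
        a + (d ∸ a)                ≡⟨ ℕ.m+[n∸m]≡n (ℕ.≤ᵇ⇒≤ a d a≤d) ⟩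
        d ∎
        where
        open +-*-Solver
        open ℕ.≤-Reasoning
        a = miss b (adjᵇ y x)
        Y = load b y ps
        X = load b x ps
        D = defect b ps
        zeros : ∀ {m} (ps : Vec (Fin n) m) → sum (map (λ _ → 0) ps) ≡ 0
        zeros []       = refl
        zeros (_ ∷ ps) = zeros ps

    -- A row is discarded only on a clash, and the clash exhibits a pattern.
    extend-sound : ∀ {m u x} {vs : Vec (Fin n) m} {D} → Unique (u ∷ x ∷ vs) → All U (u ∷ x ∷ vs) →
      row u vs ∈ D →
      row u (x ∷ vs) ∈ extend pats (row x vs) (triangle vs) D ⊎ Any (Occurs U) pats
    extend-sound {u = u} {x} {vs} uniq Uvs u∈
      with T? (any (clash (row u (x ∷ vs)) (row x vs) (triangle vs)) pats)
    ... | yes hit = inj₂ (Any.map (clash-sound uniq Uvs _) (any⁻ _ pats hit))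
    ... | no ¬hit = inj₁ (∈-concatMap⁺ _ (Any.map
      (λ { refl → ∈-filter⁺ (compatible? pats (row x vs) (triangle vs)) (both (adjᵇ u x)) ¬hit }) u∈))
      where
      both : ∀ b → (b ∷ row u vs) ∈ (false ∷ row u vs) ∷ (true ∷ row u vs) ∷ []
      both false = here refl
      both true  = there (here refl)

    -- The invariant is that every vertex of `U` is placed or has its row in `D`. The search
    -- verified both branches; whether an unplaced vertex with row `t` exists decides which one is
    -- followed.
    search-sound : ∀ {m} fuel (vs : Vec (Fin n) m) (κs : List (Vec (Fin (suc c)) m)) D →
      Unique vs → All U vs → (∀ {κ} → κ ∈ κs → Proper vs κ) → (∀ u → U u → u V.∈ vs ⊎ row u vs ∈ D) →
      T (search pats fuel (triangle vs) κs D) → Colourable U (suc c) ⊎ Any (Occurs U) pats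
    search-sound (suc fuel) vs (κ ∷ _) [] uniq Uvs κs-proper covered ok = inj₁ (col , proper)
        where
        chosen : ∀ u → U u → u V.∈ vs
        chosen u Uu with covered u Uu
        ... | inj₁ u∈ = u∈
        col : Fin n → Fin (suc c)
        col u with u ∈ᵥ? vs
        ... | yes u∈ = lookup κ (VAny.index u∈)
        -- A default colour; by `chosen`, no vertex of `U` receives it.
        ... | no _   = zero
        proper : ∀ i j → U i → U j → Adj G i j → col i ≢ col j
        proper i j Ui Uj ij with i ∈ᵥ? vs | j ∈ᵥ? vs
        ... | no i∉ | _ = contradiction (chosen i Ui) i∉
        ... | yes _ | no j∉ = contradiction (chosen j Uj) j∉
        ... | yes i∈ | yes j∈ = κs-proper (here refl) _ _
          (Eq.subst₂ (Adj G) (lookup-index i∈) (lookup-index j∈) ij)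
    search-sound (suc fuel) vs κs (t ∷ D) uniq Uvs κs-proper covered ok
      with ok₁ , ok₂ ← Equivalence.to
             (T-∧ {search pats fuel (t ∷ triangle vs) (recolour t κs) (extend pats t (triangle vs) (t ∷ D))}) ok
      with Fin.any? (λ x → U? x ×-dec ¬? (x ∈ᵥ? vs) ×-dec ≡-dec Bool._≟_ (row x vs) t)
    ... | no none = search-sound fuel vs κs D uniq Uvs κs-proper covered′ ok₂
      where
      covered′ : ∀ u → U u → u V.∈ vs ⊎ row u vs ∈ D
      covered′ u Uu with u ∈ᵥ? vs
      ... | yes u∈ = inj₁ u∈
      ... | no u∉ with covered u Uu
      ...   | inj₁ u∈ = inj₁ u∈
      ...   | inj₂ (here eq) = contradiction (u , Uu , u∉ , eq) none
      ...   | inj₂ (there r∈) = inj₂ r∈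
    -- Once `x` is placed, each vertex either keeps a listed row or gives a pattern; `∀-⊎` turns
    -- this into the invariant for all vertices, or one pattern.
    ... | yes (x , Ux , x∉ , refl) =
      [ (λ covered′ → search-sound fuel (x ∷ vs) _ _ uniq′ (Ux ∷ Uvs)
                        (recolour-sound x vs κs-proper) covered′ ok₁)
      , inj₂ ]′ (∀-⊎ cover)
      where
      fresh : ∀ {m u} {ws : Vec (Fin n) m} → ¬ u V.∈ ws → All (u ≢_) ws
      fresh {ws = []} u∉ = []
      fresh {ws = w ∷ ws} u∉ = (u∉ ∘ VAny.here) ∷ fresh (u∉ ∘ VAny.there)
      uniq′ : Unique (x ∷ vs)
      uniq′ = fresh x∉ ∷ uniq
      cover : ∀ u → (U u → u V.∈ x ∷ vs ⊎ row u (x ∷ vs) ∈ _) ⊎ Any (Occurs U) pats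
      cover u with U? u | u ∈ᵥ? (x ∷ vs)
      ... | no ¬Uu | _ = inj₁ λ Uu → contradiction Uu ¬Uu
      ... | yes _ | yes u∈ = inj₁ λ _ → inj₁ u∈
      ... | yes Uu | no u∉ with covered u Uu
      ...   | inj₁ u∈ = contradiction (VAny.there u∈) u∉
      ...   | inj₂ r∈ with extend-sound (fresh u∉ ∷ uniq′) (Uu ∷ Ux ∷ Uvs) r∈
      ...     | inj₁ r∈′ = inj₁ λ _ → inj₂ r∈′
      ...     | inj₂ occ = inj₂ occ

  -- Cliques, independent sets and maximal independent sets.

  record Homogeneous (U : Fin n → Set) (b : Bool) (k : ℕ) : Set where
    field
      vertex    : Fin k → Fin n
      inside    : ∀ i → U (vertex i)
      injective : Injective _≡_ _≡_ vertex
      mono      : ∀ i j → i ≢ j → adjᵇ (vertex i) (vertex j) ≡ b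

  homogeneous : ∀ {U : Fin n → Set} {b k} {vs : Vec (Fin n) k} →
    All U vs → Unique vs → Mono b vs → Homogeneous U b k
  homogeneous {vs = vs} Uvs uniq m = record
    { vertex = lookup vs ; inside = All.lookup⁺ Uvs ; injective = lookup-injective uniq _ _ ; mono = m }

  record MaximalIndependent (U : Fin n → Set) (S : List (Fin n)) : Set where
    field
      inside      : ∀ {s} → s ∈ S → U s
      independent : ∀ {s t} → s ∈ S → t ∈ S → ¬ Adj G s t
      dominating  : ∀ {u} → U u → u ∉ S → ∃ λ s → s ∈ S × Adj G u s

  -- A greedy scan: a vertex of `U` without a neighbour in the current set is added. A vertex
  -- blocked at its turn stays dominated, since the set only grows.
  maximal-extension : ∀ {U : Fin n → Set} → Decidable U → (S : List (Fin n)) →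
    (∀ {s} → s ∈ S → U s) → (∀ {s t} → s ∈ S → t ∈ S → ¬ Adj G s t) →
    ∃ λ S′ → (∀ {s} → s ∈ S → s ∈ S′) × MaximalIndependent U S′
  maximal-extension {U} U? S inS indS with go (List.allFin n) S inS indS
    where
    go : ∀ L S → (∀ {s} → s ∈ S → U s) → (∀ {s t} → s ∈ S → t ∈ S → ¬ Adj G s t) →
      ∃ λ S′ → (∀ {s} → s ∈ S → s ∈ S′) × (∀ {s} → s ∈ S′ → U s) ×
        (∀ {s t} → s ∈ S′ → t ∈ S′ → ¬ Adj G s t) ×
        (∀ {u} → u ∈ L → U u → u ∉ S′ → Any (Adj G u) S′)
    go [] S inS indS = S , id , inS , indS , λ ()
    go (u ∷ L) S inS indS with U? u ×-dec ¬? (Any.any? (adj? G u) S)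
    ... | no blocked
      with S′ , sub , in′ , ind′ , dom ← go L S inS indS =
      S′ , sub , in′ , ind′ , λ
        { (here refl) Uu _ → Any-resp-⊆ sub
            (decidable-stable (Any.any? (adj? G u) S) λ ¬a → blocked (Uu , ¬a))
        ; (there u∈) → dom u∈ }
    ... | yes (Uu , free)
      with S′ , sub , in′ , ind′ , dom ← go L (u ∷ S) (λ { (here refl) → Uu ; (there s∈) → inS s∈ })
             (λ { (here refl) (here refl) → irrefl G
                ; (here refl) (there t∈) → λ ut → free (lose t∈ ut)
                ; (there s∈) (here refl) → λ su → free (lose s∈ (Graph.sym G su))
                ; (there s∈) (there t∈) → indS s∈ t∈ }) =
      S′ , sub ∘ there , in′ , ind′ , λ
        { (here refl) _ u∉ → contradiction (sub (here refl)) u∉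
        ; (there u∈) → dom u∈ }
  ... | S′ , sub , in′ , ind′ , dom =
    S′ , sub , record
      { inside = in′ ; independent = ind′ ; dominating = λ {u} Uu u∉ → find (dom (∈-allFin u) Uu u∉) }

  -- A maximum clique that avoids a maximal independent set.

  module Colouring (K5-e-free : Free K5-e G) (K2∪2K1-free : Free K2∪2K1 G) where

    open ListDec (Fin._≟_ {n}) using (_∈?_)

    module CliqueOutside {U : Fin n → Set} {w} (noClique : ¬ Homogeneous U true (suc w))
        {S} (S-maximal : MaximalIndependent U S)
        (Q : Homogeneous (λ u → U u × u ∉ S) true w) where

      open MaximalIndependent S-maximal
      open Homogeneous Q using (mono)
        renaming (vertex to q; inside to q-inside; injective to q-injective)

      -- Otherwise `s` would extend `Q` to a clique of size `suc w`.
      misses : ∀ {s} → s ∈ S → ∃ λ i → ¬ Adj G (q i) s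
      misses {s} s∈ with Fin.any? (λ i → ¬? (adj? G (q i) s))
      ... | yes found = found
      ... | no none = ⊥-elim (noClique record
        { vertex    = λ { zero → s ; (suc i) → q i }
        ; inside    = λ { zero → inside s∈ ; (suc i) → proj₁ (q-inside i) }
        ; injective = λ
          { {zero} {zero} _ → refl
          ; {zero} {suc j} s≡q → contradiction (subst (_∈ S) s≡q s∈) (proj₂ (q-inside j))
          ; {suc i} {zero} q≡s → contradiction (subst (_∈ S) (Eq.sym q≡s) s∈) (proj₂ (q-inside i))
          ; {suc i} {suc j} eq → cong suc (q-injective eq) }
        ; mono      = λ
          { zero zero 0≢0 → contradiction refl 0≢0
          ; zero (suc j) _ → trans (adjᵇ-sym s (q j)) (all-adj j)
          ; (suc i) zero _ → all-adj i
          ; (suc i) (suc j) i≢j → mono i j (i≢j ∘ cong suc) } })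
        where
        all-adj : ∀ i → adjᵇ (q i) s ≡ true
        all-adj i = dec-true (adj? G (q i) s) (decidable-stable (adj? G (q i) s) λ ¬a → none (i , ¬a))

      -- By maximality `q i` has a neighbour `r` in `S`. If it missed both `s` and `t`, these four
      -- vertices would span only the edge from `q i` to `r`.
      misses-≤1 : ∀ i {s t} → s ∈ S → t ∈ S → s ≢ t → ¬ Adj G (q i) s → Adj G (q i) t
      misses-≤1 i {s} {t} s∈ t∈ s≢t ¬is with adj? G (q i) t
      ... | yes it = it
      ... | no ¬it with r , r∈ , ir ← dominating (proj₁ (q-inside i)) (proj₂ (q-inside i)) =
        contradiction ir (adj⁻ (sparse K2∪2K1-free (q i ∷ r ∷ s ∷ t ∷ []) uniq defect≤ 0F 1F λ ()))
        where
        outside : ∀ {s} → s ∈ S → q i ≢ s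
        outside s∈ refl = proj₂ (q-inside i) s∈
        uniq : Unique (q i ∷ r ∷ s ∷ t ∷ [])
        uniq = (outside r∈ ∷ outside s∈ ∷ outside t∈ ∷ [])
             ∷ ((λ { refl → ¬is ir }) ∷ (λ { refl → ¬it ir }) ∷ [])
             ∷ (s≢t ∷ []) ∷ [] ∷ []
        defect≤ : defect false (q i ∷ r ∷ s ∷ t ∷ []) ≤ 1
        defect≤ rewrite dec-true (adj? G (q i) r) ir | dec-false (adj? G (q i) s) ¬is
          | dec-false (adj? G (q i) t) ¬it | dec-false (adj? G r s) (independent r∈ s∈)
          | dec-false (adj? G r t) (independent r∈ t∈) | dec-false (adj? G s t) (independent s∈ t∈) = s≤s z≤n

      -- With a vertex `q l` that `s` misses, three neighbours of `s` in `Q` would give five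
      -- vertices with the single non-edge between `s` and `q l`.
      adjacent-to-≤2 : ∀ {s} → s ∈ S → ∀ {i j k} → i ≢ j → i ≢ k → j ≢ k →
        Adj G (q i) s → Adj G (q j) s → Adj G (q k) s → ⊥
      adjacent-to-≤2 {s} s∈ {i} {j} {k} i≢j i≢k j≢k is js ks with l , ¬ls ← misses s∈ =
        contradiction (adj⁺ (dense K5-e-free vs uniq defect≤ 1F 0F λ ())) ¬ls
        where
        vs : Vec (Fin n) 5
        vs = s ∷ q l ∷ q i ∷ q j ∷ q k ∷ []
        outside : ∀ x → s ≢ q x
        outside x refl = proj₂ (q-inside x) s∈
        apart : ∀ {x} → Adj G (q x) s → l ≢ x
        apart xs refl = ¬ls xs
        uniq : Unique vs
        uniq = (outside l ∷ outside i ∷ outside j ∷ outside k ∷ [])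
             ∷ ((apart is ∘ q-injective) ∷ (apart js ∘ q-injective) ∷ (apart ks ∘ q-injective) ∷ [])
             ∷ ((i≢j ∘ q-injective) ∷ (i≢k ∘ q-injective) ∷ [])
             ∷ ((j≢k ∘ q-injective) ∷ []) ∷ [] ∷ []
        defect≤ : defect true vs ≤ 1
        defect≤ rewrite dec-false (adj? G s (q l)) (¬ls ∘ Graph.sym G)
          | dec-true (adj? G s (q i)) (Graph.sym G is) | dec-true (adj? G s (q j)) (Graph.sym G js)
          | dec-true (adj? G s (q k)) (Graph.sym G ks)
          | mono l i (apart is) | mono l j (apart js) | mono l k (apart ks)
          | mono i j i≢j | mono i k i≢k | mono j k j≢k = s≤s z≤n

      -- Among `suc w` vertices of `S`, two would miss the same one of the `w` vertices of `Q`,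
      -- against `misses-≤1`.
      few-independent : (f : Fin (suc w) → Fin n) → Injective _≡_ _≡_ f → (∀ i → f i ∈ S) → ⊥
      few-independent f f-inj f∈ with i , j , i<j , eq ← Fin.pigeonhole (ℕ.n<1+n w) (proj₁ ∘ misses ∘ f∈) =
        proj₂ (misses (f∈ j)) (misses-≤1 (proj₁ (misses (f∈ j))) (f∈ i) (f∈ j) (Fin.<⇒≢ i<j ∘ f-inj)
          (subst (λ x → ¬ Adj G (q x) (f i)) eq (proj₂ (misses (f∈ i)))))

      adjacent-to-rest : ∀ {m} (f : Fin (suc m) → Fin n) → Injective _≡_ _≡_ f → (∀ x → f x ∈ S) →
        ∀ i → ∃ λ x → ∀ y → y ≢ x → Adj G (q i) (f y)
      adjacent-to-rest f f-inj f∈ i with Fin.any? (λ x → ¬? (adj? G (q i) (f x)))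
      ... | yes (x , ¬ix) = x , λ y y≢x → misses-≤1 i (f∈ x) (f∈ y) (y≢x ∘ Eq.sym ∘ f-inj) ¬ix
      -- `q i` misses none of the listed vertices, so any index may serve as the exception.
      ... | no none = zero , λ y _ → decidable-stable (adj? G (q i) (f y)) λ ¬iy → none (y , ¬iy)

      -- Each of the four clique vertices has at most one exception among the three, so two of them
      -- share the index `x`. Both are adjacent to the other two vertices of `S`; a third clique
      -- vertex then misses both, against `misses-≤1`.
      no-three-independent : (e : Fin 4 → Fin w) → Injective _≡_ _≡_ e →
        (f : Fin 3 → Fin n) → Injective _≡_ _≡_ f → (∀ x → f x ∈ S) → ⊥
      no-three-independent e e-inj f f-inj f∈
        with i , j , i<j , eq ← Fin.pigeonhole (ℕ.n<1+n 3) (proj₁ ∘ adjacent-to-rest f f-inj f∈ ∘ e)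
        with k , k≢i , k≢j ← third i j =
        non-adjacent (punchIn x 1F) (Fin.punchInᵢ≢i x 1F)
          (misses-≤1 (e k) (f∈ _) (f∈ _)
            (λ fy≡fz → contradiction (Fin.punchIn-injective x 0F 1F (f-inj fy≡fz)) λ ())
            (non-adjacent (punchIn x 0F) (Fin.punchInᵢ≢i x 0F)))
        where
        x : Fin 3
        x = proj₁ (adjacent-to-rest f f-inj f∈ (e i))
        non-adjacent : ∀ y → y ≢ x → ¬ Adj G (q (e k)) (f y)
        non-adjacent y y≢x = adjacent-to-≤2 (f∈ y)
          (Fin.<⇒≢ i<j ∘ e-inj) (≢-sym k≢i ∘ e-inj) (≢-sym k≢j ∘ e-inj)
          (proj₂ (adjacent-to-rest f f-inj f∈ (e i)) y y≢x)
          (proj₂ (adjacent-to-rest f f-inj f∈ (e j)) y (subst (y ≢_) eq y≢x))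

      -- A clique vertex that misses `s` still has a neighbour in `S`.
      another : ∀ {s} → s ∈ S → ∃ λ t → t ∈ S × s ≢ t
      another {s} s∈ with Any.any? (λ t → ¬? (s Fin.≟ t)) S
      ... | yes found = find found
      ... | no alone
        with i , ¬is ← misses s∈
        with t , t∈ , it ← dominating (proj₁ (q-inside i)) (proj₂ (q-inside i)) =
        contradiction (subst (Adj G (q i)) t≡s it) ¬is
        where
        t≡s = decidable-stable (t Fin.≟ s) λ t≢s → alone (lose t∈ (≢-sym t≢s))

      -- Three of five clique vertices agree about `s`. If adjacent to it, they violate
      -- `adjacent-to-≤2` at `s`; if not, all three are adjacent to `t`, and they violate it there.
      nothing-outside-large : (e : Fin 5 → Fin w) → Injective _≡_ _≡_ e → ∀ {s} → s ∈ S → ⊥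
      nothing-outside-large e e-inj {s} s∈
        with t , t∈ , s≢t ← another s∈
        with i , j , k , (i≢j , i≢k , j≢k) , ji , ki ← majority (λ i → adjᵇ (q (e i)) s)
        = three _ refl ji ki
        where
        three : ∀ b → adjᵇ (q (e i)) s ≡ b → adjᵇ (q (e j)) s ≡ adjᵇ (q (e i)) s →
          adjᵇ (q (e k)) s ≡ adjᵇ (q (e i)) s → ⊥
        three true is js ks = adjacent-to-≤2 s∈ (i≢j ∘ e-inj) (i≢k ∘ e-inj) (j≢k ∘ e-inj)
          (adj⁺ is) (adj⁺ (trans js is)) (adj⁺ (trans ks is))
        three false is js ks = adjacent-to-≤2 t∈ (i≢j ∘ e-inj) (i≢k ∘ e-inj) (j≢k ∘ e-inj)
          (other is) (other (trans js is)) (other (trans ks is))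
          where
          other : ∀ {x} → adjᵇ (q x) s ≡ false → Adj G (q x) t
          other xs = misses-≤1 _ s∈ t∈ s≢t (adj⁻ xs)

    open CliqueOutside

    -- Induction on the clique number.

    remove : ∀ {U : Fin n → Set} {c S} → MaximalIndependent U S →
      Colourable (λ u → U u × u ∉ S) c → Colourable U (suc c)
    remove {U} {c} {S} S-max (col , proper) = col′ , proper′
      where
      col′ : Fin n → Fin (suc c)
      col′ u with u ∈? S
      ... | yes _ = zero
      ... | no _  = suc (col u)
      proper′ : ∀ i j → U i → U j → Adj G i j → col′ i ≢ col′ j
      proper′ i j Ui Uj ij with i ∈? S | j ∈? S
      ... | yes i∈ | yes j∈ = contradiction ij (MaximalIndependent.independent S-max i∈ j∈)
      ... | yes _  | no _   = λ ()
      ... | no _   | yes _  = λ ()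
      ... | no i∉  | no j∉  = proper i j (Ui , i∉) (Uj , j∉) ij ∘ Fin.suc-injective

    singleton : ∀ {U : Fin n → Set} {u} → U u → Homogeneous U true 1
    singleton {u = u} Uu = homogeneous (Uu ∷ []) ([] ∷ []) λ { 0F 0F 0≢0 → contradiction refl 0≢0 }

    -- All induced subgraphs are covered at once, because deleting `S` changes `U`; `w` is an upper
    -- bound for ω.
    CliqueFreeColourable : ℕ → Set₁
    CliqueFreeColourable w = ∀ (U : Fin n → Set) → Decidable U →
      ¬ Homogeneous U true (suc w) → Colourable U (suc w)

    -- If an extension `S` of the given independent set meets every clique of size `suc w`, the
    -- induction hypothesis colours the rest and `S` takes one new colour.
    remove-independent : ∀ {U : Fin n → Set} {w k} → Decidable U → CliqueFreeColourable w →
      Homogeneous U false k →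
      (∀ {S} → MaximalIndependent U S → Homogeneous (λ u → U u × u ∉ S) true (suc w) →
        (f : Fin k → Fin n) → Injective _≡_ _≡_ f → (∀ i → f i ∈ S) → ⊥) →
      Colourable U (suc (suc w))
    remove-independent {U} {w} {k} U? IH I impossible =
      let S , sub , S-max = maximal-extension U? (List.tabulate vertex) inS indS in
      remove S-max (IH _ (λ u → U? u ×-dec ¬? (u ∈? S))
        λ Q → impossible S-max Q vertex injective (λ i → sub (∈-tabulate⁺ i)))
      where
      open Homogeneous I
      inS : ∀ {s} → s ∈ List.tabulate vertex → U s
      inS s∈ with i , refl ← ∈-tabulate⁻ s∈ = inside i
      indS : ∀ {s t} → s ∈ List.tabulate vertex → t ∈ List.tabulate vertex → ¬ Adj G s t
      indS s∈ t∈ st with i , refl ← ∈-tabulate⁻ s∈ with j , refl ← ∈-tabulate⁻ t∈ =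
        adj⁻ (mono i j (λ { refl → irrefl G st })) st

    clique-free-colourable : ∀ w → CliqueFreeColourable w
    clique-free-colourable 0 U U? noClique = (λ _ → zero) , λ i _ Ui _ _ → contradiction (singleton Ui) noClique
    clique-free-colourable (suc w) U U? noClique = colour w (clique-free-colourable w) noClique
      where
      explore : ∀ {c pats} → Verified c pats → Colourable U (suc c) ⊎ Any (Occurs U) pats
      explore (verified fuel ok) =
        -- With nothing placed every row is empty, so the list holding the empty row covers all of
        -- `U`.
        SearchSoundness.search-sound U? _ _ fuel [] ([] ∷ []) ([] ∷ []) [] [] (λ _ ()) (λ _ _ → inj₂ (here refl)) ok
      clean : ∀ {k b} → Occurs U pattern⟨ k , 0 , b ⟩ → Homogeneous U b (2 + k)
      clean {b = b} (vs , Uvs , uniq , le) = homogeneous Uvs uniq (defect≡0 b vs (ℕ.n≤0⇒n≡0 le))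
      -- The argument is one less than the clique bound: the clauses for 0 to 3 treat ω = 1 to 4,
      -- and the last one ω ≥ 5.
      colour : ∀ w → CliqueFreeColourable w → ¬ Homogeneous U true (suc (suc w)) → Colourable U (suc (suc w))
      colour 0 IH noClique with explore verified₁
      ... | inj₁ done = done
      ... | inj₂ (here occ) = remove-independent U? IH (clean occ) (few-independent noClique)
      ... | inj₂ (there (here occ)) = contradiction (clean occ) noClique
      colour 1 IH noClique with explore verified₂
      ... | inj₁ done = done
      ... | inj₂ (here occ) = remove-independent U? IH (clean occ) (few-independent noClique)
      ... | inj₂ (there (here occ)) = contradiction (clean occ) noClique
      colour 2 IH noClique with explore verified₃
      ... | inj₁ done = done
      ... | inj₂ (here (vs , Uvs , uniq , le)) =
        remove-independent U? IH (homogeneous Uvs uniq (sparse K2∪2K1-free vs uniq le))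
          (few-independent noClique)
      ... | inj₂ (there (here occ)) = contradiction (clean occ) noClique
      colour 3 IH noClique with explore verified₄
      ... | inj₁ done = done
      ... | inj₂ (here occ) =
        remove-independent U? IH (clean occ) (λ S-max Q → no-three-independent noClique S-max Q id id)
      ... | inj₂ (there (here (vs , Uvs , uniq , le))) =
        contradiction (homogeneous Uvs uniq (dense K5-e-free vs uniq le)) noClique
      colour (suc (suc (suc (suc k)))) IH noClique with Fin.any? U?
      ... | no empty = (λ _ → zero) , λ i _ Ui _ _ → contradiction (i , Ui) empty
      -- One vertex is enough to start `S`; `_↑ˡ k` picks the first five vertices of the clique.
      ... | yes (u , Uu) = remove-independent {k = 1} U? IH
        (homogeneous (Uu ∷ []) ([] ∷ []) λ { 0F 0F 0≢0 → contradiction refl 0≢0 })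
        (λ S-max Q f _ f∈ → nothing-outside-large noClique S-max Q (_↑ˡ k) (Fin.↑ˡ-injective k _ _) (f∈ 0F))

theorem4 : (n : ℕ) (G : Graph n) (w : ℕ) →
    Free K5-e G → Free K2∪2K1 G →
    IsCliqueNumber G w → ChromaticAtMost G (suc w)
theorem4 n G w K5-e-free K2∪2K1-free (_ , noClique)
  = let col , proper = clique-free-colourable w (λ _ → ⊤) (λ _ → yes tt) (λ Q → noClique record
          { vert     = Homogeneous.vertex Q
          ; vert-inj = Homogeneous.injective Q
          ; vert-adj = λ i j i≢j → adj⁺ (Homogeneous.mono Q i j i≢j) })
    in col , λ i j → proper i j tt tt
  where
  open Semantics G
  open Colouring K5-e-free K2∪2K1-free
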